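{- Let $L$ be a continuous lattice with a fixed basis $B_L$ such that $\bot\notin B_L$, let $E$ be a system of $m$ equations over $L$ of the form $\boldsymbol{x}=_{\boldsymbol{\eta}}\boldsymbol{f}(\boldsymbol{x})$ with solution $\boldsymbol{u}\in L^m$, and let $\mathit{decrease}\subseteq L^3$ be a well-founded predicate. Then the modified game is correct: for all $(v_i,i)\in L\times\underline{m}$, if $\exists$ has a winning strategy in the modified game starting from $(v_i,i)$, then $v_i\sqsubseteq u_i$.
   Context: "Lattice" means complete lattice $(L,\sqsubseteq)$, with bottom $\bot$. $\underline{m}=\{1,\dots,m\}$. A basis of $L$ is $B_L\subseteq L$ with $l=\bigsqcup\{b\in B_L\mid b\sqsubseteq l\}$ for every $l\in L$. $l\ll l'$ iff for every directed $D\subseteq L$ with $l'\sqsubseteq\bigsqcup D$ there is $d\in D$ with $l\sqsubseteq d$. $L$ is continuous if $l=\bigsqcup\{l'\mid l'\ll l\}$ for all $l$. Systems: a system $E$ of $m$ equations is an ordered list $x_i=_{\eta_i} f_i(x_1,\dots,x_m)$, $i\in\underline{m}$, with $f_i\colon L^m\to L$ monotone and $\eta_i\in\{\mu,\nu\}$. $E[x_i:=l]$ is obtained by removing the $i$-th equation and replacing $x_i$ by $l$ in the others. The solution is $\mathrm{sol}(\emptyset)=()$, $\mathrm{sol}(E)=(\mathrm{sol}(E[x_m:=u_m]),u_m)$ with $u_m=\eta_m(\lambda x.\,f_m(\mathrm{sol}(E[x_m:=x]),x))$ (least fixpoint for $\mu$, greatest for $\nu$). Let $\mathbf{E}(b,j)=\{\boldsymbol{l}\in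 L^m\mid b\sqsubseteq f_j(\boldsymbol{l})\}$. A predicate $\mathit{decrease}\subseteq L^3$ is well-founded if there exist no $v\in L$ and sequences $b^n,l^n\in L$ ($n\in\mathbb{N}$) such that $b^{n+1}\ll l^n\sqsubseteq b^n\ll v$ and $\mathit{decrease}(v,b^n,l^n)$ for all $n$. Modified game (parametrised by $\mathit{decrease}$): the state consists of a (partially defined) vector $\boldsymbol{v}\in L^m$, with associated basis elements $b_k$, and a current index $j$. The game starts on some $(v_i,i)\in L\times\underline{m}$: only component $v_i$ is set, and the current index is $j:=i$. Player $\forall$ chooses $b_i\in B_L$ with $b_i\ll v_i$. Then at a generic step: $\exists$ chooses $\boldsymbol{l}\in\mathbf{E}(b_j,j)$; $\forall$ chooses an index $k\in\underline{m}$ and $j:=k$. Then: - if the current index was already set to $k$ earlier in the play and no higher index has occurred in between: if $\eta_k=\nu$, $\exists$ wins if $l_k\sqsubseteq v_k$ and $\forall$ wins otherwise; if $\eta_k=\mu$, $\exists$ wins if $l_k\sqsubseteq b_k$ and $\mathit{decrease}(v_k,b_k,l_k)$, and $\forall$ wins otherwise; - otherwise $v_k:=l_k$, $\forall$ chooses $b_k\in B_L$ with $b_k\ll v_k$, and the play continues with the next step. A player who is unable to move loses. -}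

module Defs where

open import Level using (Level; Lift; _⊔_) renaming (suc to lsuc)
open import Data.Empty using (⊥)
open import Data.Fin using (Fin; zero; suc; fromℕ; punchIn; _<_)
open import Data.List using (List; []; _∷_)
open import Data.List.NonEmpty using (List⁺; _∷_; head; toList; _∷⁺_)
open import Data.Nat using (ℕ; zero; suc)
open import Data.Product using (Σ-syntax; ∃-syntax; _×_; _,_)
open import Data.Unit.Polymorphic using (⊤)
open import Data.Vec.Functional using (Vector; insertAt)
open import Relation.Binary.Bundles using (Poset)
open import Relation.Nullary using (¬_)
open import Relation.Unary using (Pred)

-- Subsets of the carrier are predicates at the universe level ℓ of the order.
-- Under excluded middle every predicate, at whatever level, is equivalent to
-- one at level ℓ, so these are then all the subsets.
record CompleteLattice (c ℓ₁ ℓ : Level) : Set (lsuc (c ⊔ ℓ₁ ⊔ ℓ)) where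
  field
    poset : Poset c ℓ₁ ℓ

  open Poset poset public renaming (_≤_ to _⊑_)

  IsLub : ∀ {p} → Pred Carrier p → Carrier → Set (c ⊔ ℓ ⊔ p)
  IsLub P x = (∀ y → P y → y ⊑ x) × (∀ z → (∀ y → P y → y ⊑ z) → x ⊑ z)

  IsGlb : ∀ {p} → Pred Carrier p → Carrier → Set (c ⊔ ℓ ⊔ p)
  IsGlb P x = (∀ y → P y → x ⊑ y) × (∀ z → (∀ y → P y → z ⊑ y) → z ⊑ x)

  field
    ⨆ ⨅     : Pred Carrier ℓ → Carrier
    ⨆-isLub : ∀ P → IsLub P (⨆ P)
    ⨅-isGlb : ∀ P → IsGlb P (⨅ P)

  bottom : Carrier
  bottom = ⨆ (λ _ → Lift ℓ ⊥)

  IsDirected : Pred Carrier ℓ → Set (c ⊔ ℓ)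
  IsDirected D =
    (∃[ d ] D d) ×
    (∀ x y → D x → D y → ∃[ z ] (D z × x ⊑ z × y ⊑ z))

  _≪_ : Carrier → Carrier → Set (c ⊔ lsuc ℓ)
  x ≪ y = ∀ D → IsDirected D → y ⊑ ⨆ D → ∃[ d ] (D d × x ⊑ d)

  -- The set { y ∣ y ≪ x } lives above level ℓ, hence IsLub rather than ⨆.
  IsContinuous : Set (c ⊔ lsuc ℓ)
  IsContinuous = ∀ x → IsLub (λ y → y ≪ x) x

  IsBasis : Pred Carrier ℓ → Set (c ⊔ ℓ₁)
  IsBasis B = ∀ x → x ≈ ⨆ (λ b → B b × b ⊑ x)

  IsLeastFixpoint IsGreatestFixpoint : (Carrier → Carrier) → Carrier → Set (c ⊔ ℓ₁ ⊔ ℓ)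
  IsLeastFixpoint    f x = f x ≈ x × (∀ y → f y ≈ y → x ⊑ y)
  IsGreatestFixpoint f x = f x ≈ x × (∀ y → f y ≈ y → y ⊑ x)

data FixType : Set where
  μ ν : FixType

module _ {c ℓ₁ ℓ : Level} (L : CompleteLattice c ℓ₁ ℓ) where
  open CompleteLattice L

  IsFixpoint : FixType → (Carrier → Carrier) → Carrier → Set (c ⊔ ℓ₁ ⊔ ℓ)
  IsFixpoint μ = IsLeastFixpoint
  IsFixpoint ν = IsGreatestFixpoint

  record Equation (m : ℕ) : Set (c ⊔ ℓ) where
    constructor equation
    field
      η    : FixType
      f    : Vector Carrier m → Carrier
      mono : ∀ {k l} → (∀ i → k i ⊑ l i) → f k ⊑ f l

  open Equation

  System : ℕ → Set (c ⊔ ℓ)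
  System m = Vector (Equation m) m

  insertAt-mono : ∀ {m} {k l : Vector Carrier m} (i : Fin (suc m)) (x : Carrier) →
                  (∀ j → k j ⊑ l j) → ∀ j → insertAt k i x j ⊑ insertAt l i x j
  insertAt-mono             zero    x k⊑l zero    = refl
  insertAt-mono             zero    x k⊑l (suc j) = k⊑l j
  insertAt-mono {m = suc m} (suc i) x k⊑l zero    = k⊑l zero
  insertAt-mono {m = suc m} (suc i) x k⊑l (suc j) = insertAt-mono i x (λ j → k⊑l (suc j)) j

  _[_≔_] : ∀ {m} → System (suc m) → Fin (suc m) → Carrier → System m
  (E [ i ≔ x ]) j = equation
    (η (E (punchIn i j)))
    (λ k → f (E (punchIn i j)) (insertAt k i x))
    (λ k⊑l → mono (E (punchIn i j)) (insertAt-mono i x k⊑l))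

  -- The recursion defining sol(E), stated as a relation "u is sol(E)"; the
  -- function s is x ↦ sol(E[xₘ:=x]), and `fromℕ m` is the last of the indices
  -- of a system of suc m equations.
  IsSolution : ∀ {m} → System m → Vector Carrier m → Set (c ⊔ ℓ₁ ⊔ ℓ)
  IsSolution {zero}  E u = ⊤
  IsSolution {suc m} E u =
    Σ[ s ∈ (Carrier → Vector Carrier m) ]
      (∀ x → IsSolution (E [ fromℕ m ≔ x ]) (s x)) ×
      (Σ[ uₘ ∈ Carrier ]
        IsFixpoint (η (E (fromℕ m))) (λ x → f (E (fromℕ m)) (insertAt (s x) (fromℕ m) x)) uₘ ×
        (∀ i → u i ≈ insertAt (s uₘ) (fromℕ m) uₘ i))

  TernaryPredicate : Set (c ⊔ lsuc ℓ)
  TernaryPredicate = Carrier → Carrier → Carrier → Set ℓ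

  IsWellFounded : TernaryPredicate → Set (c ⊔ lsuc ℓ)
  IsWellFounded decrease =
    ¬ (Σ[ v ∈ Carrier ] Σ[ b ∈ (ℕ → Carrier) ] Σ[ l ∈ (ℕ → Carrier) ]
        (∀ n → b (suc n) ≪ l n × l n ⊑ b n × b n ≪ v × decrease v (b n) (l n)))

  -- A play is recorded, most recent entry first, as the list of the indices
  -- that became current, each with the value vₖ and the basis element bₖ set at
  -- that moment.  The state of the game is determined by it: the current index
  -- is that of the head, and the current vₖ, bₖ are those of the most recent
  -- entry for k.
  record Entry (m : ℕ) : Set c where
    constructor entry
    field
      index : Fin m
      value : Carrier
      basis : Carrier

  open Entry

  Play : ℕ → Set c
  Play m = List⁺ (Entry m)

  -- Recurs k v b h: the index k was set earlier in h, no higher index has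
  -- occurred since, and the current vₖ and bₖ are v and b.
  data Recurs {m} (k : Fin m) (v b : Carrier) : List (Entry m) → Set c where
    here  : ∀ {h} → Recurs k v b (entry k v b ∷ h)
    there : ∀ {e h} → index e < k → Recurs k v b h → Recurs k v b (e ∷ h)

  module _ (B : Pred Carrier ℓ) {m : ℕ} (E : System m) (decrease : TernaryPredicate) where

    𝐄 : Carrier → Fin m → Pred (Vector Carrier m) ℓ
    𝐄 b j l = b ⊑ f (E j) l

    -- ∃ wins when an index of the given type recurs, with vₖ, bₖ, lₖ = v, b, l.
    ∃-Wins : FixType → (v b l : Carrier) → Set ℓ
    ∃-Wins ν v b l = l ⊑ v
    ∃-Wins μ v b l = l ⊑ b × decrease v b l

    -- A strategy for ∃ may depend on the whole play so far.
    Strategy : Set c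
    Strategy = Play m → Vector Carrier m

    -- The plays in which it is the turn of ∃, arising when ∃ follows σ and ∀
    -- moves arbitrarily.
    data Reachable (σ : Strategy) (v₀ : Carrier) (i : Fin m) : Pred (Play m) (c ⊔ lsuc ℓ) where
      start : ∀ {b} → B b → b ≪ v₀ → Reachable σ v₀ i (entry i v₀ b ∷ [])
      step  : ∀ {h b} → Reachable σ v₀ i h →
              (k : Fin m) → ¬ (∃[ v ] ∃[ b′ ] Recurs k v b′ (toList h)) →
              B b → b ≪ σ h k →
              Reachable σ v₀ i (entry k (σ h k) b ∷⁺ h)

    -- σ always gives a legal move, and wins whenever ∀ then makes an index
    -- recur.  A play where ∀ has no basis element to choose is won by ∃ and
    -- needs no condition.  There are no infinite plays: the highest index
    -- visited infinitely often would eventually recur.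
    IsWinning : Strategy → Carrier → Fin m → Set (c ⊔ lsuc ℓ)
    IsWinning σ v₀ i = ∀ h → Reachable σ v₀ i h →
      𝐄 (basis (head h)) (index (head h)) (σ h) ×
      (∀ k v b → Recurs k v b (toList h) → ∃-Wins (η (E k)) v b (σ h k))

    ∃-HasWinningStrategy : Carrier → Fin m → Set (c ⊔ lsuc ℓ)
    ∃-HasWinningStrategy v₀ i = ∃[ σ ] IsWinning σ v₀ i

{-# OPTIONS --safe #-}

-- Induction on the number n of equations of E[xₘ:=yₘ]…[xₙ₊₁:=yₙ₊₁]: suppose the
-- play stands where no index ≤ n can recur, v is the value ∃ offers at j ≤ n, and
-- as long as the play stays among the indices ≤ n the values offered at a higher
-- index k are bounded by yₖ.  Then v is below the j-th component of the solution.
-- It is enough to see this at the top index n, with right-hand side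
-- g y = fₙ(sol(E[xₙ:=y]), y):
--   * η = ν: until n recurs it is offered values ⊑ v only, so the induction
--     hypothesis for y = v yields b ⊑ g v for all b ≪ v, so v is a post-fixpoint.
--   * η = μ: if n recurs after ∀ chose b with an offer l ⊑ b, any b′ ≪ l was also
--     a legal choice instead of b.  Since decrease is well-founded, by induction
--     b′ ⊑ μg for all these b′; so l ⊑ μg, and then b ⊑ g(μg) = μg.
module Submission where

open import Axiom.ExcludedMiddle using (ExcludedMiddle)
open import Data.Empty using (⊥-elim)
open import Data.Fin using (Fin; zero; suc; fromℕ; punchIn; toℕ)
open import Data.Fin.Properties using (toℕ-fromℕ; toℕ<n)
open import Data.List using (List; _∷_)
open import Data.List.NonEmpty using (_∷_; toList)
open import Data.Nat using (ℕ; zero; suc; _<_)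
open import Data.Nat.Properties using (<-asym; <-irrefl; m<n⇒m<1+n; n<1+n)
open import Data.Product using (Σ-syntax; ∃-syntax; _×_; _,_; proj₁; proj₂)
open import Data.Unit.Polymorphic using (⊤)
open import Data.Vec.Functional using (Vector; insertAt)
open import Data.Vec.Functional.Properties using (insertAt-lookup; insertAt-punchIn)
open import Function using (_∘_; id)
open import Induction.InfiniteDescent using (InfiniteDescendingSequence)
open import Induction.WellFounded using (Acc; acc; WellFounded)
open import Level using (Level; _⊔_) renaming (suc to lsuc)
open import Relation.Binary.Core using (Rel)
open import Relation.Binary.PropositionalEquality as ≡ using (_≡_; cong; subst; subst₂)
open import Relation.Nullary using (¬_)
open import Relation.Nullary.Decidable using (decidable-stable)
open import Relation.Unary using (Pred)
open import Defs

-- Vectors with an inserted component, and well-founded relations.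

toℕ-punchIn-fromℕ : ∀ {n} (j : Fin n) → toℕ (punchIn (fromℕ n) j) ≡ toℕ j
toℕ-punchIn-fromℕ zero    = ≡.refl
toℕ-punchIn-fromℕ (suc j) = cong suc (toℕ-punchIn-fromℕ j)

insertAt-elim : ∀ {a p} {A : Set a} {n} (P : Fin (suc n) → A → Set p)
                (xs : Vector A n) (i : Fin (suc n)) (x : A) →
                P i x → (∀ j → P (punchIn i j) (xs j)) → ∀ k → P k (insertAt xs i x k)
insertAt-elim             P xs zero    x p q zero    = p
insertAt-elim             P xs zero    x p q (suc k) = q k
insertAt-elim {n = suc n} P xs (suc i) x p q zero    = q zero
insertAt-elim {n = suc n} P xs (suc i) x p q (suc k) =
  insertAt-elim (P ∘ suc) (xs ∘ suc) i x p (q ∘ suc) k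

-- Excluded middle for types decides Σ-types with their witnesses, which gives
-- the dependent choice needed here.
noInfiniteDescent⇒wellFounded :
  (∀ {a} → ExcludedMiddle a) → ∀ {a r} {A : Set a} {_≺_ : Rel A r} →
  ¬ (∃[ s ] InfiniteDescendingSequence _≺_ s) → WellFounded _≺_
noInfiniteDescent⇒wellFounded em {A = A} {_≺_} noDescent x = decidable-stable em λ ¬acc →
  noDescent (proj₁ ∘ descent (x , ¬acc) , λ n → proj₂ (predecessor (descent (x , ¬acc) n)))
  where
  Inaccessible : Set _
  Inaccessible = Σ[ y ∈ A ] ¬ Acc _≺_ y

  predecessor : ((y , _) : Inaccessible) → Σ[ (z , _) ∈ Inaccessible ] z ≺ y
  predecessor (y , ¬acc) = decidable-stable em λ none →
    ¬acc (acc λ {z} z≺y → decidable-stable em λ ¬acc-z → none ((z , ¬acc-z) , z≺y))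

  descent : Inaccessible → ℕ → Inaccessible
  descent y zero    = y
  descent y (suc n) = proj₁ (predecessor (descent y n))

module _ {c ℓ₁ ℓ : Level} (L : CompleteLattice c ℓ₁ ℓ) where
  open CompleteLattice L
  open Equation

  -- Monotonicity of solutions.

  private
    _⊑ᵛ_ : ∀ {n} → Rel (Vector Carrier n) ℓ
    k ⊑ᵛ l = ∀ i → k i ⊑ l i

  insertAt-mono₂ : ∀ {n} {k l : Vector Carrier n} (i : Fin (suc n)) {x y : Carrier} →
                   k ⊑ᵛ l → x ⊑ y → insertAt k i x ⊑ᵛ insertAt l i y
  insertAt-mono₂ {k = k} {l} i {x} {y} k⊑l x⊑y =
    insertAt-elim (λ j z → z ⊑ insertAt l i y j) k i x
      (subst (x ⊑_) (≡.sym (insertAt-lookup l i y)) x⊑y)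
      (λ j → subst (k j ⊑_) (≡.sym (insertAt-punchIn l i y j)) (k⊑l j))

  module _ {g : Carrier → Carrier} (g-mono : ∀ {x y} → x ⊑ y → g x ⊑ g y) where

    -- The meet `z` of all `x` with `g x ⊑ x` is itself a fixpoint, so `u`, least among the
    -- fixpoints, lies below `z`.
    leastFixpoint-induction : ∀ {u} → IsLeastFixpoint g u → ∀ {y} → g y ⊑ y → u ⊑ y
    leastFixpoint-induction (_ , least) {y} gy⊑y =
      trans (least z (antisym gz⊑z z⊑gz)) (lower y gy⊑y)
      where
      z : Carrier
      z = ⨅ (λ x → g x ⊑ x)
      lower : ∀ x → g x ⊑ x → z ⊑ x
      lower = proj₁ (⨅-isGlb _)
      gz⊑z : g z ⊑ z
      gz⊑z = proj₂ (⨅-isGlb _) (g z) λ x gx⊑x → trans (g-mono (lower x gx⊑x)) gx⊑x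
      z⊑gz : z ⊑ g z
      z⊑gz = lower (g z) (g-mono gz⊑z)

    greatestFixpoint-coinduction : ∀ {u} → IsGreatestFixpoint g u → ∀ {y} → y ⊑ g y → y ⊑ u
    greatestFixpoint-coinduction (_ , greatest) {y} y⊑gy =
      trans (upper y y⊑gy) (greatest z (antisym gz⊑z z⊑gz))
      where
      z : Carrier
      z = ⨆ (λ x → x ⊑ g x)
      upper : ∀ x → x ⊑ g x → x ⊑ z
      upper = proj₁ (⨆-isLub _)
      z⊑gz : z ⊑ g z
      z⊑gz = proj₂ (⨆-isLub _) (g z) λ x x⊑gx → trans x⊑gx (g-mono (upper x x⊑gx))
      gz⊑z : g z ⊑ z
      gz⊑z = upper (g z) (g-mono z⊑gz)

  fixpoint-mono : ∀ φ {g g′ : Carrier → Carrier} →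
                  (∀ {x y} → x ⊑ y → g x ⊑ g y) → (∀ {x y} → x ⊑ y → g′ x ⊑ g′ y) →
                  (∀ x → g x ⊑ g′ x) →
                  ∀ {u u′} → IsFixpoint L φ g u → IsFixpoint L φ g′ u′ → u ⊑ u′
  fixpoint-mono μ g-mono g′-mono g⊑g′ fix (g′u′≈u′ , _) =
    leastFixpoint-induction g-mono fix (trans (g⊑g′ _) (reflexive g′u′≈u′))
  fixpoint-mono ν g-mono g′-mono g⊑g′ (gu≈u , _) fix′ =
    greatestFixpoint-coinduction g′-mono fix′ (trans (reflexive (Eq.sym gu≈u)) (g⊑g′ _))

  -- `f-⊑` compares values at two vectors `k ⊑ᵛ l`, so that substituting `x ⊑ y` in the two systems
  -- preserves the relation.
  record _⊑ˢ_ {n} (F G : System L n) : Set (c ⊔ ℓ) where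
    field
      η-≡ : ∀ j → η (F j) ≡ η (G j)
      f-⊑ : ∀ j {k l} → k ⊑ᵛ l → f (F j) k ⊑ f (G j) l

  open _⊑ˢ_

  ⊑ˢ-refl : ∀ {n} (F : System L n) → F ⊑ˢ F
  ⊑ˢ-refl F = record { η-≡ = λ _ → ≡.refl ; f-⊑ = λ j → mono (F j) }

  ≔-mono : ∀ {n} {F G : System L (suc n)} (i : Fin (suc n)) {x y : Carrier} →
           F ⊑ˢ G → x ⊑ y → _[_≔_] L F i x ⊑ˢ _[_≔_] L G i y
  ≔-mono i F⊑G x⊑y = record
    { η-≡ = λ j → η-≡ F⊑G (punchIn i j)
    ; f-⊑ = λ j k⊑l → f-⊑ F⊑G (punchIn i j) (insertAt-mono₂ i k⊑l x⊑y)
    }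

  solution-mono : ∀ {n} {F G : System L n} → F ⊑ˢ G → ∀ {s t} →
                  IsSolution L F s → IsSolution L G t → s ⊑ᵛ t
  solution-mono {suc n} {F} {G} F⊑G (s , s-sol , u , u-fix , u-eq) (t , t-sol , w , w-fix , w-eq) i =
    trans (reflexive (u-eq i))
      (trans (insertAt-mono₂ (fromℕ n) (solution-mono (≔-mono _ F⊑G u⊑w) (s-sol u) (t-sol w)) u⊑w i)
        (reflexive (Eq.sym (w-eq i))))
    where
    -- Stated for arbitrary systems: with the same system twice it gives the monotonicity of a
    -- right-hand side that `fixpoint-mono` asks for.
    rhs-mono : ∀ {F G : System L (suc n)} {s t : Carrier → Vector Carrier n} → F ⊑ˢ G →
               (∀ x → IsSolution L (_[_≔_] L F (fromℕ n) x) (s x)) →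
               (∀ x → IsSolution L (_[_≔_] L G (fromℕ n) x) (t x)) →
               ∀ {x y} → x ⊑ y →
               f (F (fromℕ n)) (insertAt (s x) (fromℕ n) x) ⊑
               f (G (fromℕ n)) (insertAt (t y) (fromℕ n) y)
    rhs-mono F⊑G s-sol t-sol x⊑y = f-⊑ F⊑G (fromℕ n)
      (insertAt-mono₂ (fromℕ n) (solution-mono (≔-mono (fromℕ n) F⊑G x⊑y) (s-sol _) (t-sol _)) x⊑y)

    u⊑w : u ⊑ w
    u⊑w = fixpoint-mono (η (G (fromℕ n)))
      (rhs-mono (⊑ˢ-refl F) s-sol s-sol) (rhs-mono (⊑ˢ-refl G) t-sol t-sol)
      (λ x → rhs-mono F⊑G s-sol t-sol refl)
      (subst (λ φ → IsFixpoint L φ _ u) (η-≡ F⊑G (fromℕ n)) u-fix) w-fix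

  -- The way-below relation.

  ≪-⊑-trans : ∀ {x y z} → x ≪ y → y ⊑ z → x ≪ z
  ≪-⊑-trans x≪y y⊑z D dir z⊑⨆D = x≪y D dir (trans y⊑z z⊑⨆D)

  ⊑-≪-trans : ∀ {x y z} → x ⊑ y → y ≪ z → x ≪ z
  ⊑-≪-trans x⊑y y≪z D dir z⊑⨆D with y≪z D dir z⊑⨆D
  ... | d , d∈D , y⊑d = d , d∈D , trans x⊑y y⊑d

  ≪-trans : ∀ {x y z} → x ≪ y → y ≪ z → x ≪ z
  ≪-trans x≪y y≪z D dir z⊑⨆D with y≪z D dir z⊑⨆D
  ... | d , d∈D , y⊑d = x≪y D dir (trans y⊑d (proj₁ (⨆-isLub D) d d∈D))

  -- `v` is the supremum of the `y ≪ v`, each such `y` that of the basis elements `b ⊑ y`, and these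
  -- satisfy `b ≪ v`.
  ≪-basis-least : IsContinuous → ∀ {B : Pred Carrier ℓ} → IsBasis B →
                  ∀ {v z} → (∀ {b} → B b → b ≪ v → b ⊑ z) → v ⊑ z
  ≪-basis-least cont basis {v} {z} bound = proj₂ (cont v) z λ y y≪v →
    trans (reflexive (basis y)) (proj₂ (⨆-isLub _) z λ b (b∈B , b⊑y) →
      bound b∈B (⊑-≪-trans b⊑y y≪v))

  module _ (decrease : TernaryPredicate L) (v : Carrier) where

    -- The link between consecutive terms of the sequences that `IsWellFounded` excludes, for a
    -- fixed `v`.
    _≺_ : Rel Carrier (c ⊔ lsuc ℓ)
    b′ ≺ b = Σ[ l ∈ Carrier ] (b′ ≪ l × l ⊑ b × b ≪ v × decrease v b l)

    ≺-wellFounded : (∀ {a} → ExcludedMiddle a) → IsWellFounded L decrease → WellFounded _≺_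
    ≺-wellFounded em wf = noInfiniteDescent⇒wellFounded em λ (b , desc) →
      wf (v , b , proj₁ ∘ desc , proj₂ ∘ desc)

  -- Continuations of a play.

  data Extends {m} (n : ℕ) (h₀ : List (Entry L m)) : Pred (List (Entry L m)) c where
    stop : Extends n h₀ h₀
    play : ∀ {e h} → toℕ (Entry.index e) < n → Extends n h₀ h → Extends n h₀ (e ∷ h)

  extends-suc : ∀ {m n} {h₀ h : List (Entry L m)} → Extends n h₀ h → Extends (suc n) h₀ h
  extends-suc stop           = stop
  extends-suc (play e<n ext) = play (m<n⇒m<1+n e<n) (extends-suc ext)

  extends-trans : ∀ {m n} {h₀ h₁ h₂ : List (Entry L m)} →
                  Extends n h₀ h₁ → Extends n h₁ h₂ → Extends n h₀ h₂
  extends-trans ext stop            = ext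
  extends-trans ext (play e<n ext′) = play e<n (extends-trans ext ext′)

  -- Entries added to `h₀` have index below `k`, so they neither cancel a recurrence of `k` nor, for
  -- the converse, create one.
  extends-recurs⁺ : ∀ {m n} {k : Fin m} {v b h₀ h} → toℕ k ≡ n → Extends n h₀ h →
                    Recurs L k v b h₀ → Recurs L k v b h
  extends-recurs⁺ k≡n stop           r = r
  extends-recurs⁺ k≡n (play e<n ext) r =
    there (subst (_ <_) (≡.sym k≡n) e<n) (extends-recurs⁺ k≡n ext r)

  extends-recurs⁻ : ∀ {m n} {k : Fin m} {v b h₀ h} → toℕ k ≡ n → Extends n h₀ h →
                    Recurs L k v b h → Recurs L k v b h₀
  extends-recurs⁻ k≡n stop           r           = r
  extends-recurs⁻ k≡n (play e<n ext) here        = ⊥-elim (<-irrefl k≡n e<n)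
  extends-recurs⁻ k≡n (play e<n ext) (there _ r) = extends-recurs⁻ k≡n ext r

  ¬recurs-below : ∀ {m} {i k : Fin m} {v w b b′ h} → toℕ k < toℕ i →
                  ¬ Recurs L k w b′ (entry i v b ∷ h)
  ¬recurs-below k<i here          = <-irrefl ≡.refl k<i
  ¬recurs-below k<i (there i<k _) = <-asym k<i i<k

  -- Subsystems and correctness of the game.

  module _ {m : ℕ} (E : System L m) where

    -- A system obtained from E by repeatedly substituting for the last variable;
    -- Bound holds for the vectors below the substituted values.
    record Subsystem (n : ℕ) : Set (c ⊔ lsuc ℓ) where
      field
        F     : System L n
        ι     : Fin n → Fin m
        toℕ-ι : ∀ j → toℕ (ι j) ≡ toℕ j
        η-ι   : ∀ j → η (F j) ≡ η (E (ι j))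
        Bound : Pred (Vector Carrier m) ℓ
        f-ι   : ∀ j l k → Bound l → (l ∘ ι) ⊑ᵛ k → f (E (ι j)) l ⊑ f (F j) k

    whole : Subsystem m
    whole = record
      { F     = E
      ; ι     = id
      ; toℕ-ι = λ _ → ≡.refl
      ; η-ι   = λ _ → ≡.refl
      ; Bound = λ _ → ⊤
      ; f-ι   = λ j _ _ _ → mono (E j)
      }

    restrict : ∀ {n} → Subsystem (suc n) → Carrier → Subsystem n
    restrict {n} S y = record
      { F     = _[_≔_] L F (fromℕ n) y
      ; ι     = ι ∘ punchIn (fromℕ n)
      ; toℕ-ι = λ j → ≡.trans (toℕ-ι _) (toℕ-punchIn-fromℕ j)
      ; η-ι   = η-ι ∘ punchIn (fromℕ n)
      ; Bound = λ l → Bound l × l (ι (fromℕ n)) ⊑ y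
      -- The new conjunct of `Bound` covers the component where `y` is inserted.
      ; f-ι   = λ j l k (bd , l⊑y) l⊑k → f-ι _ l _ bd
                  (insertAt-elim (λ i z → l (ι i) ⊑ z) k (fromℕ n) y l⊑y l⊑k)
      }
      where open Subsystem S

    module _ (em : ∀ {a} → ExcludedMiddle a)
             (cont : IsContinuous) {B : Pred Carrier ℓ} (basis : IsBasis B)
             {decrease : TernaryPredicate L} (wf : IsWellFounded L decrease)
             {v₀ : Carrier} {i₀ : Fin m} {σ : Strategy L B E decrease}
             (winning : IsWinning L B E decrease σ v₀ i₀) where

      private
        Reach : Pred (Play L m) (c ⊔ lsuc ℓ)
        Reach = Reachable L B E decrease σ v₀ i₀

      -- v is the value about to be set for k after the play h₀, which is empty
      -- at the start of the game.
      Offered : List (Entry L m) → Fin m → Carrier → Set (c ⊔ lsuc ℓ)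
      Offered h₀ k v = ∀ {b} → B b → b ≪ v → Reach (entry k v b ∷ h₀)

      offer : ∀ {h} → Reach h → ∀ k → (∀ {v b} → ¬ Recurs L k v b (toList h)) →
              Offered (toList h) k (σ h k)
      offer r k ¬rec = step r k (λ (_ , _ , rec) → ¬rec rec)

      offered-⊑-solution :
        ∀ {n} (S : Subsystem n) →
        let open Subsystem S in
        ∀ {s} → IsSolution L F s →
        ∀ {h₀} → (∀ j {v b} → ¬ Recurs L (ι j) v b h₀) →
        (∀ {h} → Reach h → Extends n h₀ (toList h) → Bound (σ h)) →
        ∀ j {v} → Offered h₀ (ι j) v → v ⊑ s j
      offered-⊑-solution {suc n} S {s′} (s , s-sol , u , u-fix , u-eq) {h₀} fresh bounded j {v} off =
        trans
          -- The top component comes first. It then bounds the offers at `t` in the call for the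
          -- lower ones, which is why `offered-top` speaks of all continuations of `h₀`.
          (insertAt-elim (λ i z → ∀ {v} → Offered h₀ (ι i) v → v ⊑ z) (s u) top u
            (offered-top stop)
            (λ i → offered-⊑-solution (restrict S u) (s-sol u) (fresh ∘ punchIn top)
              (λ r ext → bounded r (extends-suc ext) ,
                         offered-top (extends-suc ext)
                           (offer r t λ rec → fresh top (extends-recurs⁻ t≡n ext rec)))
              i)
            j off)
          (reflexive (Eq.sym (u-eq j)))
        where
        open Subsystem S

        top : Fin (suc n)
        top = fromℕ n

        t : Fin m
        t = ι top

        t≡n : toℕ t ≡ n
        t≡n = ≡.trans (toℕ-ι top) (toℕ-fromℕ n)

        rhs : Carrier → Carrier
        rhs x = f (F top) (insertAt (s x) top x)

        rhs-mono : ∀ {x y} → x ⊑ y → rhs x ⊑ rhs y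
        rhs-mono x⊑y = mono (F top) (insertAt-mono₂ top
          (solution-mono (≔-mono top (⊑ˢ-refl F) x⊑y) (s-sol _) (s-sol _)) x⊑y)

        low<t : ∀ i → toℕ (ι (punchIn top i)) < toℕ t
        low<t i = subst₂ _<_ (≡.sym (Subsystem.toℕ-ι (restrict S u) i)) (≡.sym t≡n) (toℕ<n i)

        -- The reply `l` of ∃ lies below the solution for `y` with `y` inserted: at `t` because `t`
        -- could recur at once, at lower indices by the induction hypothesis from this play on.
        basis-⊑-rhs : ∀ {h₁ v b y} → Extends (suc n) h₀ h₁ → Reach (entry t v b ∷ h₁) →
                      (∀ {h} → Reach h → Recurs L t v b (toList h) → σ h t ⊑ y) → b ⊑ rhs y
        basis-⊑-rhs {y = y} ext r recur⊑y =
          trans (proj₁ (winning _ r)) (f-ι top l _ (bounded r ext′)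
            (insertAt-elim (λ i z → l (ι i) ⊑ z) (s y) top y
              (recur⊑y r here)
              λ i → offered-⊑-solution (restrict S y) (s-sol y)
                -- The entry for `t` just made blocks every lower recurrence.
                (λ i → ¬recurs-below (low<t i))
                (λ r′ low → bounded r′ (extends-trans ext′ (extends-suc low)) ,
                            recur⊑y r′ (extends-recurs⁺ t≡n low here))
                i (offer r _ (¬recurs-below (low<t i)))))
          where
          l    = σ (entry t _ _ ∷ _)
          ext′ = play (subst (_< suc n) (≡.sym t≡n) (n<1+n n)) ext

        -- The type is a variable `φ`, so that matching on it refines both the fixpoint property and
        -- the winning condition.
        offered-top-by : ∀ φ → IsFixpoint L φ rhs u →
          (∀ {h v b} → Reach h → Recurs L t v b (toList h) → ∃-Wins L B E decrease φ v b (σ h t)) →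
          ∀ {h₁ v} → Extends (suc n) h₀ h₁ → Offered h₁ t v → v ⊑ u
        offered-top-by ν fix win ext off = greatestFixpoint-coinduction rhs-mono fix
          (≪-basis-least cont basis λ b∈B b≪v → basis-⊑-rhs ext (off b∈B b≪v) win)
        offered-top-by μ (rhsu≈u , _) win {h₁} {v} ext off =
          ≪-basis-least cont basis λ b∈B b≪v → below b∈B b≪v (≺-wellFounded decrease v em wf _)
          where
          below : ∀ {b} → B b → b ≪ v → Acc (_≺_ decrease v) b → b ⊑ u
          below b∈B b≪v (acc rec) = trans
            (basis-⊑-rhs ext (off b∈B b≪v) λ r recurs →
              let l⊑b , dec = win r recurs in
              -- The recursion goes back to `h₁`, with `b′` chosen there in place of `b`.
              ≪-basis-least cont basis λ b′∈B b′≪l →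
                below b′∈B (≪-trans (≪-⊑-trans b′≪l l⊑b) b≪v) (rec (_ , b′≪l , l⊑b , b≪v , dec)))
            (reflexive rhsu≈u)

        offered-top : ∀ {h₁ v} → Extends (suc n) h₀ h₁ → Offered h₁ t v → v ⊑ u
        offered-top = offered-top-by (η (F top)) u-fix
          λ {h} r rec → subst (λ φ → ∃-Wins L B E decrease φ _ _ (σ h t)) (≡.sym (η-ι top))
                          (proj₂ (winning h r) t _ _ rec)

proposition7p5 : (∀ {a} → ExcludedMiddle a) →
    ∀ {c ℓ₁ ℓ} (L : CompleteLattice c ℓ₁ ℓ) →
    let open CompleteLattice L in
    IsContinuous →
    (B : Pred Carrier ℓ) → IsBasis B → (∀ b → B b → ¬ (b ≈ bottom)) →
    (m : ℕ) (E : System L m) (u : Vector Carrier m) → IsSolution L E u →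
    (decrease : TernaryPredicate L) → IsWellFounded L decrease →
    ∀ (vᵢ : Carrier) (i : Fin m) →
    ∃-HasWinningStrategy L B E decrease vᵢ i → vᵢ ⊑ u i
proposition7p5 em L cont B basis _ m E u sol decrease wf vᵢ i (σ , winning) =
  -- Before the game no index is set, so none recurs; the whole system imposes no bound, and `start`
  -- is the offer of `vᵢ`.
  offered-⊑-solution L E em cont basis wf winning (whole L E) sol (λ _ ()) _ i start
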